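{- For all positive integers $d$ and $k$ there exists a constant $c=c(d,k)$ such that for every graph $G$ on $n$ vertices with maximum degree at most $d$, \[\hat{R}^{[k]}(BG,BG) \leq cn.\]
   Context: A $[k]$-graph is a hypergraph $\mathcal{H}=(V,E)$, $E\subseteq 2^V$, in which every edge has cardinality in $\{1,\dots,k\}$. It is covering if every pair of distinct vertices is contained in some edge. For a graph $G$, $\mathcal{H}$ contains a blue (resp. red) Berge-$G$ if there is an injection $\varphi:V(G)\to V(\mathcal{H})$ and an injection $f:E(G)\to E(\mathcal{H})$ with $\varphi(e)\subseteq f(e)$ and $f(e)$ blue (resp. red) for every $e\in E(G)$. The cover Ramsey number $\hat{R}^{[k]}(BG_1,BG_2)$ is the smallest integer $n_0$ such that for every covering $[k]$-graph $\mathcal{H}$ on $n\geq n_0$ vertices and every blue/red coloring of the edges of $\mathcal{H}$, there is either a blue Berge-$G_1$ or a red Berge-$G_2$ in $\mathcal{H}$. -}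

module Defs where

open import Data.Nat using (ℕ; _≤_; _<_)
open import Data.Bool using (Bool; true; false; T)
open import Data.Fin using (Fin; toℕ)
open import Data.Fin.Subset using (Subset; _∈_; ∣_∣)
open import Data.List using (length; filterᵇ; allFin)
open import Data.Sum using (_⊎_)
open import Data.Product using (Σ; _×_; _,_; proj₁; ∃)
open import Relation.Binary.PropositionalEquality using (_≡_; _≢_)
open import Function.Definitions using (Injective)

record Graph (n : ℕ) : Set where
  field
    adj     : Fin n → Fin n → Bool
    symm    : ∀ u v → adj u v ≡ adj v u
    irrefl  : ∀ v → adj v v ≡ false
open Graph public

degree : ∀ {n} → Graph n → Fin n → ℕ
degree {n} G v = length (filterᵇ (adj G v) (allFin n))

MaxDegreeAtMost : ∀ {n} → Graph n → ℕ → Set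
MaxDegreeAtMost {n} G d = ∀ (v : Fin n) → degree G v ≤ d

-- Edges of G: unordered pairs {u,v}, represented canonically by u < v.
GEdge : ∀ {n} → Graph n → Set
GEdge {n} G = Σ (Fin n × Fin n) λ p → (toℕ (proj₁ p) < toℕ (Data.Product.proj₂ p)) × T (adj G (proj₁ p) (Data.Product.proj₂ p))

-- A [k]-graph on vertex set Fin N with m edges: the edge set is the
-- image of an injective map Fin m → Subset N (so E ⊆ 2^V, no repeats),
-- every edge having cardinality in {1,…,k}.
record KGraph (k N : ℕ) : Set where
  field
    m       : ℕ
    edge    : Fin m → Subset N
    distinct : Injective _≡_ _≡_ edge
    sizeLo  : ∀ e → 1 ≤ ∣ edge e ∣
    sizeHi  : ∀ e → ∣ edge e ∣ ≤ k
open KGraph public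

Covering : ∀ {k N} → KGraph k N → Set
Covering {k} {N} H = ∀ (x y : Fin N) → x ≢ y → ∃ λ e → (x ∈ edge H e) × (y ∈ edge H e)

data Colour : Set where
  blue red : Colour

Colouring : ∀ {k N} → KGraph k N → Set
Colouring H = Fin (m H) → Colour

BergeCopy : ∀ {k N n} (H : KGraph k N) → Colouring H → Colour → Graph n → Set
BergeCopy {k} {N} {n} H χ c G =
  Σ (Fin n → Fin N) λ φ →
  Σ (GEdge G → Fin (m H)) λ f →
    Injective _≡_ _≡_ φ ×
    (∀ e e' → f e ≡ f e' → proj₁ e ≡ proj₁ e') ×
    (∀ (e : GEdge G) →
       (φ (proj₁ (proj₁ e)) ∈ edge H (f e)) ×
       (φ (Data.Product.proj₂ (proj₁ e)) ∈ edge H (f e)) ×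
       (χ (f e) ≡ c))

-- n0 is a valid threshold for the cover Ramsey number R̂^{[k]}(BG,BG):
-- every covering [k]-graph on N ≥ n0 vertices, every blue/red colouring,
-- contains a blue Berge-G or a red Berge-G.
-- R̂^{[k]}(BG,BG) ≤ t  iff  t is a valid threshold (the property is upward closed).
CoverRamseyThreshold : ∀ {n} → ℕ → Graph n → ℕ → Set
CoverRamseyThreshold {n} k G n0 =
  ∀ (N : ℕ) → n0 ≤ N → (H : KGraph k N) → Covering H → (χ : Colouring H) →
    BergeCopy H χ blue G ⊎ BergeCopy H χ red G

{-# OPTIONS --safe #-}

-- Colour each pair x < y of vertices of H by the colour of a hyperedge e containing it together
-- with the ranks of x and y inside e. In one of these 2k² colour classes a hyperedge determines
-- the pair, so a monochromatic copy of G among the pairs is a monochromatic Berge copy.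
--
-- For the multicolour Ramsey problem, embed G greedily into one colour class F, keeping a
-- candidate set for every vertex. If the greedy embedding gets stuck, two candidate sets contain
-- large X and Y such that every x in X has few F-neighbours in Y. Iterating inside X and Y gives
-- a set, of size linear in n, on which F has arbitrarily small density. Discarding F as a defect
-- there, pass to the remaining colours; once no colour is left all pairs would be defects.

module Submission where

open import Defs
open import Algebra.Properties.Semiring.Sum as Sum using ()
open import Data.Bool using (Bool; true; false; T; _∧_; _∨_; not; if_then_else_)
open import Data.Bool.Properties using () renaming (_≟_ to _≟ᵇ_)
open import Data.Fin using (Fin; zero; suc; toℕ; fromℕ<; combine; remQuot)
open import Data.Fin.Properties as F using (any?; all?; ¬∀⟶∃¬; combine-injective; combine-injectiveʳ) renaming (_≟_ to _≟ᶠ_)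
open import Data.Fin.Subset using (Subset; _∈_; ∣_∣)
open import Data.List using (length; filterᵇ; tabulate)
open import Data.Nat using (ℕ; zero; suc; _+_; _*_; _∸_; _^_; _≤_; _<_; z≤n; s≤s; _≤?_; NonZero; >-nonZero)
open import Data.Nat.Properties
open import Data.Nat.Tactic.RingSolver using (solve-∀)
open import Data.Product using (Σ; ∃; _×_; _,_; proj₁; proj₂)
open import Data.Sum using (_⊎_; inj₁; inj₂; [_,_]′; map; map₁)
open import Data.Vec as Vec using ()
open import Data.Vec.Functional using (_∷_)
open import Function using (_∘_; id)
open import Function.Definitions using (Injective)
open import Relation.Binary.Definitions using (tri<; tri≈; tri>)
open import Relation.Binary.PropositionalEquality
open import Relation.Nullary using (Dec; yes; no; does; ¬_; contradiction)
open import Relation.Nullary.Decidable using (_×-dec_; _→-dec_; dec-true; dec-false)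

open Sum +-*-semiring using (sum; sum-cong-≗; sum-replicate-zero; ∑-distrib-+; ∑-comm; *-distribˡ-sum; *-distribʳ-sum)

-- Sets of vertices

ι : Bool → ℕ
ι false = 0
ι true  = 1

ι-∧ : ∀ a b → ι (a ∧ b) ≡ ι a * ι b
ι-∧ false b = refl
ι-∧ true  b = sym (+-identityʳ (ι b))

ι≤1 : ∀ a → ι a ≤ 1
ι≤1 false = z≤n
ι≤1 true  = ≤-refl

∧-trueˡ : ∀ {a b} → a ∧ b ≡ true → a ≡ true
∧-trueˡ {true} _ = refl

∧-trueʳ : ∀ {a b} → a ∧ b ≡ true → b ≡ true
∧-trueʳ {true} e = e

does-true : ∀ {p} {P : Set p} (P? : Dec P) → does P? ≡ true → P
does-true (yes p) _ = p

does-false : ∀ {p} {P : Set p} (P? : Dec P) → does P? ≡ false → ¬ P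
does-false (no ¬p) _ = ¬p

sum-mono-≤ : ∀ {n} {f g : Fin n → ℕ} → (∀ i → f i ≤ g i) → sum f ≤ sum g
sum-mono-≤ {zero}  f≤g = z≤n
sum-mono-≤ {suc n} f≤g = +-mono-≤ (f≤g zero) (sum-mono-≤ (f≤g ∘ suc))

term≤sum : ∀ {n} (f : Fin n → ℕ) i → f i ≤ sum f
term≤sum f zero    = m≤m+n _ _
term≤sum f (suc i) = ≤-trans (term≤sum (f ∘ suc) i) (m≤n+m _ (f zero))

VSet : ℕ → Set
VSet N = Fin N → Bool

infix 4 _⊑_
_⊑_ : ∀ {N} → VSet N → VSet N → Set
A ⊑ B = ∀ x → A x ≡ true → B x ≡ true

card : ∀ {N} → VSet N → ℕ
card A = sum (ι ∘ A)

ι-mono : ∀ {a b} → (a ≡ true → b ≡ true) → ι a ≤ ι b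
ι-mono {false} _ = z≤n
ι-mono {true}  h rewrite h refl = ≤-refl

subset-of-size : ∀ {N} (A : VSet N) w → w ≤ card A → ∃ λ B → B ⊑ A × card B ≡ w
subset-of-size {N} A zero _ = (λ _ → false) , (λ _ ()) , sum-replicate-zero N
subset-of-size {suc N} A (suc w) w≤ with A zero in eq
... | true with subset-of-size (A ∘ suc) w (≤-pred w≤)
...   | B , B⊑A , ∣B∣≡w = true ∷ B , (λ { zero _ → eq ; (suc x) → B⊑A x }) , cong suc ∣B∣≡w
subset-of-size {suc N} A (suc w) w≤ | false with subset-of-size (A ∘ suc) (suc w) w≤
...   | B , B⊑A , ∣B∣≡w = false ∷ B , (λ { (suc x) → B⊑A x }) , ∣B∣≡w

-- Otherwise `d * f i < a` throughout `S`, and summing over at most `d` indices keeps `d` times the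
-- total below `d * a`.
pigeonhole : ∀ {n} (S : VSet n) (f : Fin n → ℕ) {a d} → 1 ≤ a → 1 ≤ d → card S ≤ d →
             a ≤ sum (λ i → ι (S i) * f i) → ∃ λ i → S i ≡ true × a ≤ d * f i
pigeonhole S f {suc a} {d} _ 1≤d ∣S∣≤d a≤ with any? (λ i → (S i ≟ᵇ true) ×-dec (suc a ≤? d * f i))
... | yes found = found
... | no  none  = contradiction (*-cancelˡ-≤ d {{>-nonZero 1≤d}} chain) (<⇒≱ ≤-refl)
  where
  small : ∀ i → d * (ι (S i) * f i) ≤ ι (S i) * a
  small i with S i in eq
  ... | false = ≤-reflexive (*-zeroʳ d)
  ... | true  = begin
    d * (f i + 0)  ≡⟨ cong (d *_) (+-identityʳ (f i)) ⟩
    d * f i        ≤⟨ ≤-pred (≰⇒> (λ le → none (i , eq , le))) ⟩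
    a              ≡⟨ +-identityʳ a ⟨
    a + 0          ∎
    where open ≤-Reasoning
  open ≤-Reasoning
  chain : d * suc a ≤ d * a
  chain = begin
    d * suc a                        ≤⟨ *-monoʳ-≤ d a≤ ⟩
    d * sum (λ i → ι (S i) * f i)    ≡⟨ *-distribˡ-sum d (λ i → ι (S i) * f i) ⟩
    sum (λ i → d * (ι (S i) * f i))  ≤⟨ sum-mono-≤ small ⟩
    sum (λ i → ι (S i) * a)          ≡⟨ *-distribʳ-sum a (ι ∘ S) ⟨
    card S * a                       ≤⟨ *-monoˡ-≤ a ∣S∣≤d ⟩
    d * a                            ∎

-- Degrees and edge counts

Rel₂ : ℕ → Set
Rel₂ N = Fin N → Fin N → Bool

Symm : ∀ {N} → Rel₂ N → Set
Symm F = ∀ x y → F x y ≡ F y x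

deg : ∀ {N} → Rel₂ N → Fin N → VSet N → ℕ
deg F x B = sum (λ y → ι (B y) * ι (F x y))

-- Ordered pairs are counted, diagonal included, so for symmetric `F` an edge between distinct
-- vertices of `A` contributes twice to `pairs F A A`.
pairs : ∀ {N} → Rel₂ N → VSet N → VSet N → ℕ
pairs F A B = sum (λ x → ι (A x) * deg F x B)

deg≤card : ∀ {N} (F : Rel₂ N) x B → deg F x B ≤ card B
deg≤card F x B = sum-mono-≤ λ y → ≤-trans (*-monoʳ-≤ (ι (B y)) (ι≤1 (F x y))) (≤-reflexive (*-identityʳ _))

pairs-bound : ∀ {N} (F : Rel₂ N) A B p {c} → (∀ x → A x ≡ true → p * deg F x B ≤ c) →
              p * pairs F A B ≤ card A * c
pairs-bound F A B p {c} bound = begin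
  p * pairs F A B                         ≡⟨ *-distribˡ-sum p (λ x → ι (A x) * deg F x B) ⟩
  sum (λ x → p * (ι (A x) * deg F x B))   ≤⟨ sum-mono-≤ pointwise ⟩
  sum (λ x → ι (A x) * c)                 ≡⟨ *-distribʳ-sum c (ι ∘ A) ⟨
  card A * c                              ∎
  where
  open ≤-Reasoning
  pointwise : ∀ x → p * (ι (A x) * deg F x B) ≤ ι (A x) * c
  pointwise x with A x in eq
  ... | false = ≤-reflexive (*-zeroʳ p)
  ... | true  = begin
    p * (deg F x B + 0)  ≡⟨ cong (p *_) (+-identityʳ _) ⟩
    p * deg F x B        ≤⟨ bound x eq ⟩
    c                    ≡⟨ +-identityʳ c ⟨
    c + 0                ∎

pairs-symm : ∀ {N} (F : Rel₂ N) → Symm F → ∀ A B → pairs F A B ≡ pairs F B A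
pairs-symm F symF A B = begin
  sum (λ x → ι (A x) * sum (λ y → ι (B y) * ι (F x y)))    ≡⟨ sum-cong-≗ (λ x → *-distribˡ-sum (ι (A x)) (λ y → ι (B y) * ι (F x y))) ⟩
  sum (λ x → sum (λ y → ι (A x) * (ι (B y) * ι (F x y))))  ≡⟨ ∑-comm (λ x y → ι (A x) * (ι (B y) * ι (F x y))) ⟩
  sum (λ y → sum (λ x → ι (A x) * (ι (B y) * ι (F x y))))  ≡⟨ sum-cong-≗ (λ y → sum-cong-≗ (λ x → swap y x)) ⟩
  sum (λ y → sum (λ x → ι (B y) * (ι (A x) * ι (F y x))))  ≡⟨ sum-cong-≗ (λ y → sym (*-distribˡ-sum (ι (B y)) (λ x → ι (A x) * ι (F y x)))) ⟩
  sum (λ y → ι (B y) * sum (λ x → ι (A x) * ι (F y x)))    ∎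
  where
  open ≡-Reasoning
  exchange : ∀ a b c → a * (b * c) ≡ b * (a * c)
  exchange = solve-∀
  swap : ∀ y x → ι (A x) * (ι (B y) * ι (F x y)) ≡ ι (B y) * (ι (A x) * ι (F y x))
  swap y x rewrite symF x y = exchange (ι (A x)) (ι (B y)) (ι (F y x))

-- A single equation of indicators expresses both disjointness and union, and can be summed term by
-- term.
Partition : ∀ {N} → VSet N → VSet N → VSet N → Set
Partition A A₁ A₂ = ∀ x → ι (A x) ≡ ι (A₁ x) + ι (A₂ x)

card-partition : ∀ {N} {A A₁ A₂ : VSet N} → Partition A A₁ A₂ → card A ≡ card A₁ + card A₂
card-partition {A₁ = A₁} {A₂} part = trans (sum-cong-≗ part) (∑-distrib-+ (ι ∘ A₁) (ι ∘ A₂))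

pairs-partitionˡ : ∀ {N} (F : Rel₂ N) {A A₁ A₂ : VSet N} B → Partition A A₁ A₂ →
                   pairs F A B ≡ pairs F A₁ B + pairs F A₂ B
pairs-partitionˡ F {A₁ = A₁} {A₂} B part = trans
  (sum-cong-≗ λ x → trans (cong (_* deg F x B) (part x)) (*-distribʳ-+ (deg F x B) (ι (A₁ x)) (ι (A₂ x))))
  (∑-distrib-+ (λ x → ι (A₁ x) * deg F x B) (λ x → ι (A₂ x) * deg F x B))

pairs-partition : ∀ {N} (F : Rel₂ N) → Symm F → ∀ {A A₁ A₂} → Partition A A₁ A₂ →
                  pairs F A A ≡ pairs F A₁ A₁ + pairs F A₂ A₂ + 2 * pairs F A₂ A₁
pairs-partition F symF {A} {A₁} {A₂} part = begin
  pairs F A A                    ≡⟨ pairs-partitionˡ F {A₁ = A₁} {A₂} A part ⟩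
  pairs F A₁ A + pairs F A₂ A    ≡⟨ cong₂ _+_ (right A₁) (right A₂) ⟩
  (pairs F A₁ A₁ + pairs F A₂ A₁) + (pairs F A₁ A₂ + pairs F A₂ A₂)
    ≡⟨ cong (λ z → (pairs F A₁ A₁ + pairs F A₂ A₁) + (z + pairs F A₂ A₂)) (pairs-symm F symF A₁ A₂) ⟩
  (pairs F A₁ A₁ + pairs F A₂ A₁) + (pairs F A₂ A₁ + pairs F A₂ A₂)
    ≡⟨ collect (pairs F A₁ A₁) (pairs F A₂ A₁) (pairs F A₂ A₂) ⟩
  pairs F A₁ A₁ + pairs F A₂ A₂ + 2 * pairs F A₂ A₁ ∎
  where
  open ≡-Reasoning
  right : ∀ B → pairs F B A ≡ pairs F A₁ B + pairs F A₂ B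
  right B = trans (pairs-symm F symF B A) (pairs-partitionˡ F {A₁ = A₁} {A₂} B part)
  collect : ∀ a b c → (a + b) + (b + c) ≡ a + c + 2 * b
  collect = solve-∀

pairs-mono : ∀ {N} {F G : Rel₂ N} {A B} → (∀ x y → F x y ≡ true → G x y ≡ true) → A ⊑ B →
             pairs F A A ≤ pairs G B B
pairs-mono F⊑G A⊑B = sum-mono-≤ λ x → *-mono-≤ (ι-mono (A⊑B x))
  (sum-mono-≤ λ y → *-mono-≤ (ι-mono (A⊑B y)) (ι-mono (F⊑G x y)))

-- Greedy embedding

Embedding : ∀ {n N} → (Fin n → Fin n → Bool) → Rel₂ N → Set
Embedding {n} {N} adj F = Σ (Fin n → Fin N) λ φ → Injective _≡_ _≡_ φ ×
  (∀ i j → toℕ i < toℕ j → adj i j ≡ true → F (φ i) (φ j) ≡ true)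

module Greedy {N} (F : Rel₂ N) (U : VSet N) (P d M n₀ : ℕ)
              (1≤P : 1 ≤ P) (1≤d : 1 ≤ d) (M-large : P ^ d * n₀ < M) where

  private instance
    P≢0 : NonZero P
    P≢0 = >-nonZero 1≤P

  -- What a failed greedy step leaves behind. Sizes are multiplied by `P ^ d` to avoid division; `X`
  -- loses up to `n₀` used vertices and a factor `d`.
  SparsePair : Set
  SparsePair = Σ (VSet N) λ X → Σ (VSet N) λ Y → X ⊑ U × Y ⊑ U ×
    M ≤ P ^ d * (n₀ + d * card X) × M ≤ P ^ d * card Y ×
    (∀ x → X x ≡ true → P * deg F x Y ≤ card Y)

  -- Staying inside the candidate sets is carried along because those sets encode adjacency to the
  -- vertices placed earlier.
  Extension : ∀ {n} → (Fin n → Fin n → Bool) → (Fin n → VSet N) → VSet N → Set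
  Extension adj C used = Σ (Embedding adj F) λ (φ , _) → ∀ i → C i (φ i) ≡ true × used (φ i) ≡ false

  -- The exponent e w counts the neighbours of w that are already placed: each of them
  -- shrinks the candidate set C w by a factor of at most P.
  extend : ∀ n (adj : Fin n → Fin n → Bool) → Symm adj → (C : Fin n → VSet N) (used : VSet N) (e : Fin n → ℕ) →
           (∀ w → C w ⊑ U) → (∀ w → e w + card (adj w) ≤ d) → (∀ w → M ≤ P ^ e w * card (C w)) →
           card used + n ≤ n₀ → Extension adj C used ⊎ SparsePair
  extend zero adj _ C used e _ _ _ _ = inj₁ (((λ ()) , (λ { {()} }) , λ ()) , λ ())
  extend (suc n) adj symA C used e C⊑U budget large room = step
    where
    -- The last clause leaves every neighbour of `zero` a `1 / P` share of its candidates, which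
    -- pays for raising its exponent by one.
    Good : Fin N → Set
    Good x = C zero x ≡ true × used x ≡ false ×
             (∀ w → adj zero (suc w) ≡ true → card (C (suc w)) ≤ P * deg F x (C (suc w)))

    good? : ∀ x → Dec (Good x)
    good? x = (C zero x ≟ᵇ true) ×-dec ((used x ≟ᵇ false) ×-dec
      all? (λ w → (adj zero (suc w) ≟ᵇ true) →-dec (card (C (suc w)) ≤? P * deg F x (C (suc w)))))

    module Place (x : Fin N) (x∈C : C zero x ≡ true) (fresh : used x ≡ false)
                 (rich : ∀ w → adj zero (suc w) ≡ true → card (C (suc w)) ≤ P * deg F x (C (suc w))) where
      C′ : Fin n → VSet N
      C′ w y = C (suc w) y ∧ (if adj zero (suc w) then F x y else true)

      used′ : VSet N
      used′ y = used y ∨ does (x ≟ᶠ y)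

      e′ : Fin n → ℕ
      e′ w = ι (adj zero (suc w)) + e (suc w)

      -- Placing `zero` moves an edge to it from the unplaced degree of `w` into the exponent, so
      -- the sum is unchanged.
      budget′ : ∀ w → e′ w + card (adj (suc w) ∘ suc) ≤ d
      budget′ w = ≤-trans (≤-reflexive (trans
        (cong (λ b → ι b + e (suc w) + card (adj (suc w) ∘ suc)) (symA zero (suc w)))
        (shuffle (ι (adj (suc w) zero)) (e (suc w)) _))) (budget (suc w))
        where
        shuffle : ∀ a b c → a + b + c ≡ b + (a + c)
        shuffle = solve-∀

      card-inter : ∀ B → card (λ y → B y ∧ F x y) ≡ deg F x B
      card-inter B = sum-cong-≗ λ y → ι-∧ (B y) (F x y)

      large′ : ∀ w → M ≤ P ^ e′ w * card (C′ w)
      large′ w with adj zero (suc w) in eq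
      ... | false = ≤-trans (large (suc w)) (*-monoʳ-≤ (P ^ e (suc w))
              (sum-mono-≤ {f = ι ∘ C (suc w)} λ y → ι-mono λ c → cong (_∧ true) c))
      ... | true  = begin
        M                                                    ≤⟨ large (suc w) ⟩
        P ^ e (suc w) * card (C (suc w))                     ≤⟨ *-monoʳ-≤ (P ^ e (suc w)) (rich w eq) ⟩
        P ^ e (suc w) * (P * deg F x (C (suc w)))            ≡⟨ regroup (P ^ e (suc w)) P _ ⟩
        P * P ^ e (suc w) * deg F x (C (suc w))              ≡⟨ cong (P * P ^ e (suc w) *_) (card-inter (C (suc w))) ⟨
        P * P ^ e (suc w) * card (λ y → C (suc w) y ∧ F x y) ∎
        where
        open ≤-Reasoning
        regroup : ∀ a b c → a * (b * c) ≡ b * a * c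
        regroup = solve-∀

      room′ : card used′ + n ≤ n₀
      room′ = ≤-trans (+-monoˡ-≤ n used′≤) (≤-trans (≤-reflexive (sym (+-suc (card used) n))) room)
        where
        single : ∀ {N} (x : Fin N) → card (λ y → does (x ≟ᶠ y)) ≤ 1
        single {suc N} zero    = s≤s (≤-reflexive (sum-replicate-zero N))
        single {suc N} (suc x) = single x
        ι-∨ : ∀ a b → ι (a ∨ b) ≤ ι a + ι b
        ι-∨ false b = ≤-refl
        ι-∨ true  b = s≤s z≤n
        used′≤ : card used′ ≤ suc (card used)
        used′≤ = begin
          card used′                                              ≤⟨ sum-mono-≤ (λ y → ι-∨ (used y) _) ⟩
          sum (λ y → ι (used y) + ι (does (x ≟ᶠ y)))              ≡⟨ ∑-distrib-+ (ι ∘ used) _ ⟩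
          card used + card (λ y → does (x ≟ᶠ y))                  ≤⟨ +-monoʳ-≤ (card used) (single x) ⟩
          card used + 1                                           ≡⟨ +-comm (card used) 1 ⟩
          suc (card used)                                         ∎
          where open ≤-Reasoning

      finish : Extension (λ i j → adj (suc i) (suc j)) C′ used′ → Extension adj C used
      finish ((φ , inj , edges) , cand) = (ψ , ψ-inj _ _ , ψ-edges) , ψ-cand
        where
        ψ : Fin (suc n) → Fin N
        ψ = x ∷ φ
        unused : ∀ {a b} → a ∨ b ≡ false → a ≡ false × b ≡ false
        unused {false} e = refl , e
        apart : ∀ j → x ≢ φ j
        apart j x≡ with trans (sym (dec-true (x ≟ᶠ φ j) x≡)) (proj₂ (unused {used (φ j)} (proj₂ (cand j))))
        ... | ()
        ψ-inj : ∀ i j → ψ i ≡ ψ j → i ≡ j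
        ψ-inj zero    zero    _ = refl
        ψ-inj zero    (suc j) q = contradiction q (apart j)
        ψ-inj (suc i) zero    q = contradiction (sym q) (apart i)
        ψ-inj (suc i) (suc j) q = cong suc (inj q)
        ψ-edges : ∀ i j → toℕ i < toℕ j → adj i j ≡ true → F (ψ i) (ψ j) ≡ true
        -- `C′` was intersected with the `F`-neighbourhood of `x`, so candidate membership of `φ j`
        -- is already the required edge.
        ψ-edges zero    (suc j) _  a = trans
          (cong (λ b → if b then F x (φ j) else true) (sym a)) (∧-trueʳ {C (suc j) (φ j)} (proj₁ (cand j)))
        ψ-edges (suc i) (suc j) lt a = edges i j (≤-pred lt) a
        ψ-cand : ∀ i → C i (ψ i) ≡ true × used (ψ i) ≡ false
        ψ-cand zero    = x∈C , fresh
        ψ-cand (suc i) = ∧-trueˡ (proj₁ (cand i)) , proj₁ (unused (proj₂ (cand i)))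

    X : Fin n → VSet N
    X w x = C zero x ∧ does (P * deg F x (C (suc w)) ≤? card (C (suc w)))

    stuck : ¬ ∃ Good → SparsePair
    stuck none = X v , C (suc v) ,
      (λ x x∈X → C⊑U zero x (∧-trueˡ x∈X)) , C⊑U (suc v) ,
      ≤-trans (large₀ zero) (*-monoʳ-≤ (P ^ d) C₀≤) , large₀ (suc v) ,
      λ x x∈X → does-true (P * deg F x (C (suc v)) ≤? card (C (suc v))) (∧-trueʳ {C zero x} x∈X)
      where
      large₀ : ∀ w → M ≤ P ^ d * card (C w)
      large₀ w = ≤-trans (large w) (*-monoˡ-≤ (card (C w)) (^-monoʳ-≤ P (m+n≤o⇒m≤o (e w) (budget w))))

      used≤n₀ : card used ≤ n₀
      used≤n₀ = m+n≤o⇒m≤o (card used) room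

      -- Even after `d` shrinkings more candidates than used vertices remain, so the pigeonhole
      -- below distributes a positive number.
      n₀<C₀ : n₀ < card (C zero)
      n₀<C₀ = *-cancelˡ-< (P ^ d) n₀ (card (C zero)) (≤-trans M-large (large₀ zero))

      S : VSet n
      S w = adj zero (suc w)

      cover : ∀ x → ι (C zero x) ≤ ι (used x) + sum (λ w → ι (S w) * ι (X w x))
      cover x with C zero x in x∈C | used x in fresh
      ... | false | _     = z≤n
      ... | true  | true  = s≤s z≤n
      ... | true  | false with ¬∀⟶∃¬ n _ (λ w → (S w ≟ᵇ true) →-dec (card (C (suc w)) ≤? P * deg F x (C (suc w))))
                                 (λ rich → none (x , x∈C , fresh , rich))
      ...   | w , ¬rich = ≤-trans (one (S w ≟ᵇ true)) (term≤sum _ w)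
        where
        one : Dec (S w ≡ true) → 1 ≤ ι (S w) * ι (does (P * deg F x (C (suc w)) ≤? card (C (suc w))))
        one (no ¬s) = contradiction (λ s → contradiction s ¬s) ¬rich
        one (yes s) rewrite s | dec-true (P * deg F x (C (suc w)) ≤? card (C (suc w)))
                                  (<⇒≤ (≰⇒> (λ le → ¬rich (λ _ → le)))) = ≤-refl

      covered : card (C zero) ≤ card used + sum (λ w → ι (S w) * card (X w))
      covered = begin
        card (C zero)                                                      ≤⟨ sum-mono-≤ cover ⟩
        sum (λ x → ι (used x) + sum (λ w → ι (S w) * ι (X w x)))           ≡⟨ ∑-distrib-+ (ι ∘ used) _ ⟩
        card used + sum (λ x → sum (λ w → ι (S w) * ι (X w x)))            ≡⟨ cong (card used +_) (∑-comm (λ x w → ι (S w) * ι (X w x))) ⟩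
        card used + sum (λ w → sum (λ x → ι (S w) * ι (X w x)))
          ≡⟨ cong (card used +_) (sum-cong-≗ λ w → sym (*-distribˡ-sum (ι (S w)) (ι ∘ X w))) ⟩
        card used + sum (λ w → ι (S w) * card (X w))                       ∎
        where open ≤-Reasoning

      heavy : ∃ λ w → S w ≡ true × card (C zero) ∸ card used ≤ d * card (X w)
      heavy = pigeonhole S (card ∘ X) (m<n⇒0<n∸m (≤-<-trans used≤n₀ n₀<C₀)) 1≤d
        (≤-trans (m≤n+m _ (e zero + ι (adj zero zero))) (≤-trans (≤-reflexive (+-assoc (e zero) _ _)) (budget zero)))
        (m≤n+o⇒m∸n≤o (card (C zero)) (card used) covered)

      v : Fin n
      v = proj₁ heavy

      C₀≤ : card (C zero) ≤ n₀ + d * card (X v)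
      C₀≤ = ≤-trans (m∸n≤o⇒m≤n+o (card used) (proj₂ (proj₂ heavy))) (+-monoˡ-≤ _ used≤n₀)
        where
        m∸n≤o⇒m≤n+o : ∀ n {m o} → m ∸ n ≤ o → m ≤ n + o
        m∸n≤o⇒m≤n+o n {m} le = ≤-trans (m≤n+m∸n m n) (+-monoʳ-≤ n le)

    step : Extension adj C used ⊎ SparsePair
    step with any? good?
    ... | no none = inj₂ (stuck none)
    ... | yes (x , x∈C , fresh , rich) =
      map₁ finish (extend n (λ i j → adj (suc i) (suc j)) (λ i j → symA (suc i) (suc j)) C′ used′ e′
        (λ w y y∈C → C⊑U (suc w) y (∧-trueˡ y∈C)) budget′ large′ room′)
      where open Place x x∈C fresh rich

-- Sparse subsets

-- The step case is `P ^ d * (1 + d * Q)`, the size demanded by `embedding-or-sparsePair`. Here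
-- `P = 4 * (2 ^ h * 2 ^ h)` limits the pairs between two halves of `2 ^ h` blocks, and `Q` leaves
-- room for both recursive calls.
sparsityFactor : ℕ → ℕ → ℕ
sparsityFactor d zero    = 1
sparsityFactor d (suc h) = (4 * (2 ^ h * 2 ^ h)) ^ d * (1 + d * (2 * (sparsityFactor d h + 2 ^ h)))

module _ {n N} (adj : Fin n → Fin n → Bool) (symA : Symm adj) {d} (1≤d : 1 ≤ d)
         (deg≤d : ∀ v → card (adj v) ≤ d) (F : Rel₂ N) (symF : Symm F) where

  -- The greedy embedding starts with `U` as every candidate set. Cancelling `P ^ d` from its
  -- failure bounds leaves `w + d * (Q * w)`; the summand `w` pays for the at most `n` used
  -- vertices, and the rest gives the size of `X`.
  embedding-or-sparsePair : ∀ P Q w U → 1 ≤ P → 1 ≤ Q → 1 ≤ w → n ≤ w → P ^ d * (1 + d * Q) * w ≤ card U →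
    Embedding adj F ⊎ Σ (VSet N) λ X → Σ (VSet N) λ Y → X ⊑ U × Y ⊑ U × Q * w ≤ card X × Q * w ≤ card Y ×
      (∀ x → X x ≡ true → P * deg F x Y ≤ card Y)
  embedding-or-sparsePair P Q w U 1≤P 1≤Q 1≤w n≤w ∣U∣≥ =
    map proj₁ weaken
      (extend n adj symA (λ _ → U) (λ _ → false) (λ _ → 0) (λ _ _ → id) deg≤d
        (λ _ → ≤-trans ∣U∣≥ (≤-reflexive (sym (*-identityˡ (card U)))))
        (≤-reflexive (cong (_+ n) (sum-replicate-zero N))))
    where
    M : ℕ
    M = P ^ d * (1 + d * Q) * w

    instance
      P≢0 : NonZero P
      P≢0 = >-nonZero 1≤P
      Pᵈ≢0 : NonZero (P ^ d)
      Pᵈ≢0 = m^n≢0 P d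
      d≢0 : NonZero d
      d≢0 = >-nonZero 1≤d

    expand : ∀ p d q w → p * (1 + d * q) * w ≡ p * (w + d * (q * w))
    expand = solve-∀

    n<M/Pᵈ : n < w + d * (Q * w)
    n<M/Pᵈ = ≤-<-trans n≤w (m<m+n w (*-mono-≤ 1≤d (*-mono-≤ 1≤Q 1≤w)))

    open Greedy F U P d M n 1≤P 1≤d
      (<-≤-trans (*-monoʳ-< (P ^ d) n<M/Pᵈ) (≤-reflexive (sym (expand (P ^ d) d Q w))))

    cancel : ∀ {s} → M ≤ P ^ d * s → w + d * (Q * w) ≤ s
    cancel {s} M≤ = *-cancelˡ-≤ (P ^ d) (≤-trans (≤-reflexive (sym (expand (P ^ d) d Q w))) M≤)

    weaken : SparsePair → Σ (VSet N) λ X → Σ (VSet N) λ Y → X ⊑ U × Y ⊑ U × Q * w ≤ card X × Q * w ≤ card Y ×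
      (∀ x → X x ≡ true → P * deg F x Y ≤ card Y)
    weaken (X , Y , X⊑U , Y⊑U , M≤X , M≤Y , sparse) = X , Y , X⊑U , Y⊑U ,
      *-cancelˡ-≤ d (+-cancelˡ-≤ w (d * (Q * w)) (d * card X) (≤-trans (cancel M≤X) (+-monoˡ-≤ _ n≤w))) ,
      ≤-trans (m≤n*m (Q * w) d) (≤-trans (m≤n+m _ w) (cancel M≤Y)) , sparse

  -- Markov's inequality: at most half of Y has more than twice the average degree into W.
  low-degree-part : ∀ P W Y → 1 ≤ card W → (∀ x → W x ≡ true → P * deg F x Y ≤ card Y) →
    Σ (VSet N) λ Z → Z ⊑ Y × (∀ y → Z y ≡ true → W y ≡ false × P * deg F y W ≤ 2 * card W) ×
      card Y ≤ 2 * card W + 2 * card Z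
  low-degree-part P W Y 1≤W sparse = Z , (λ y y∈Z → ∧-trueˡ y∈Z) , Z-spec , bound
    where
    low? : ∀ y → Dec (P * deg F y W ≤ 2 * card W)
    low? y = P * deg F y W ≤? 2 * card W

    Z B : VSet N
    Z y = Y y ∧ not (W y) ∧ does (low? y)
    B y = Y y ∧ not (does (low? y))

    not-true : ∀ {b} → not b ≡ true → b ≡ false
    not-true {false} _ = refl

    Z-spec : ∀ y → Z y ≡ true → W y ≡ false × P * deg F y W ≤ 2 * card W
    Z-spec y y∈Z = not-true (∧-trueˡ rest) , does-true (low? y) (∧-trueʳ {not (W y)} rest)
      where
      rest : not (W y) ∧ does (low? y) ≡ true
      rest = ∧-trueʳ {Y y} y∈Z

    B-high : ∀ y → ι (B y) * (2 * card W) ≤ P * (ι (Y y) * deg F y W)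
    B-high y with Y y | does (low? y) in eq
    ... | false | _     = z≤n
    ... | true  | true  = z≤n
    ... | true  | false = begin
      2 * card W + 0       ≡⟨ +-identityʳ _ ⟩
      2 * card W           ≤⟨ <⇒≤ (≰⇒> (does-false (low? y) eq)) ⟩
      P * deg F y W        ≡⟨ cong (P *_) (+-identityʳ _) ⟨
      P * (deg F y W + 0)  ∎
      where open ≤-Reasoning

    -- Double counting: the pairs between `Y` and `W` are bounded below through the high degrees on
    -- `B` and above through the sparsity seen from `W`.
    2B≤Y : 2 * card B ≤ card Y
    2B≤Y = *-cancelˡ-≤ (card W) {{>-nonZero 1≤W}} (begin
      card W * (2 * card B)                      ≡⟨ shuffle (card W) (card B) ⟩
      card B * (2 * card W)                      ≡⟨ *-distribʳ-sum (2 * card W) (ι ∘ B) ⟩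
      sum (λ y → ι (B y) * (2 * card W))         ≤⟨ sum-mono-≤ B-high ⟩
      sum (λ y → P * (ι (Y y) * deg F y W))      ≡⟨ *-distribˡ-sum P (λ y → ι (Y y) * deg F y W) ⟨
      P * pairs F Y W                            ≡⟨ cong (P *_) (pairs-symm F symF Y W) ⟩
      P * pairs F W Y                            ≤⟨ pairs-bound F W Y P sparse ⟩
      card W * card Y                            ∎)
      where
      open ≤-Reasoning
      shuffle : ∀ a b → a * (2 * b) ≡ b * (2 * a)
      shuffle = solve-∀

    cover : ∀ y → ι (Y y) ≤ ι (B y) + (ι (W y) + ι (Z y))
    cover y with Y y | W y | does (low? y)
    ... | false | _     | _     = z≤n
    ... | true  | _     | false = s≤s z≤n
    ... | true  | true  | true  = s≤s z≤n
    ... | true  | false | true  = s≤s z≤n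

    Y≤ : card Y ≤ card B + (card W + card Z)
    Y≤ = begin
      card Y                                          ≤⟨ sum-mono-≤ cover ⟩
      sum (λ y → ι (B y) + (ι (W y) + ι (Z y)))       ≡⟨ ∑-distrib-+ (ι ∘ B) (λ y → ι (W y) + ι (Z y)) ⟩
      card B + sum (λ y → ι (W y) + ι (Z y))          ≡⟨ cong (card B +_) (∑-distrib-+ (ι ∘ W) (ι ∘ Z)) ⟩
      card B + (card W + card Z)                      ∎
      where open ≤-Reasoning

    bound : card Y ≤ 2 * card W + 2 * card Z
    -- Adding `card Y` on both sides lets `2B≤Y` absorb `B` without subtraction.
    bound = +-cancelˡ-≤ (card Y) _ _ (begin
      card Y + card Y                           ≡⟨ cong (card Y +_) (+-identityʳ _) ⟨
      2 * card Y                                ≤⟨ *-monoʳ-≤ 2 Y≤ ⟩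
      2 * (card B + (card W + card Z))          ≡⟨ distrib (card B) (card W) (card Z) ⟩
      2 * card B + (2 * card W + 2 * card Z)    ≤⟨ +-monoˡ-≤ _ 2B≤Y ⟩
      card Y + (2 * card W + 2 * card Z)        ∎)
      where
      open ≤-Reasoning
      distrib : ∀ a b c → 2 * (a + (b + c)) ≡ 2 * a + (2 * b + 2 * c)
      distrib = solve-∀

  -- W is assembled from 2 ^ h blocks of size w with few edges between different blocks,
  -- so that its density is at most 2 / 2 ^ h.
  embedding-or-sparseSet : ∀ h w U → 1 ≤ w → n ≤ w → sparsityFactor d h * w ≤ card U →
    Embedding adj F ⊎ Σ (VSet N) λ W → W ⊑ U × card W ≡ 2 ^ h * w ×
      pairs F W W + w * w ≤ 2 ^ suc h * (w * w)
  -- A single block: the trivial bound `w * w` on its pairs already suffices.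
  embedding-or-sparseSet zero w U _ _ ∣U∣≥ with subset-of-size U w (≤-trans (≤-reflexive (sym (*-identityˡ w))) ∣U∣≥)
  ... | W , W⊑U , ∣W∣≡w = inj₂ (W , W⊑U , trans ∣W∣≡w (sym (*-identityˡ w)) , (begin
      pairs F W W + w * w        ≡⟨ cong (_+ w * w) (*-identityˡ _) ⟨
      1 * pairs F W W + w * w    ≤⟨ +-monoˡ-≤ (w * w) (pairs-bound F W W 1 {card W} λ x _ →
                                      ≤-trans (≤-reflexive (*-identityˡ _)) (deg≤card F x W)) ⟩
      card W * card W + w * w    ≡⟨ cong (λ c → c * c + w * w) ∣W∣≡w ⟩
      w * w + w * w              ≡⟨ cong (w * w +_) (+-identityʳ _) ⟨
      2 * (w * w)                ∎))
    where open ≤-Reasoning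
  embedding-or-sparseSet (suc h) w U 1≤w n≤w ∣U∣≥
    with embedding-or-sparsePair (4 * (2 ^ h * 2 ^ h)) (2 * (sparsityFactor d h + 2 ^ h)) w U
           (≤-trans (*-mono-≤ 1≤2ʰ 1≤2ʰ) (m≤m+n _ _)) (≤-trans 1≤2ʰ (≤-trans (m≤n+m _ (sparsityFactor d h)) (m≤m+n _ _)))
           1≤w n≤w ∣U∣≥
    where
    1≤2ʰ : 1 ≤ 2 ^ h
    1≤2ʰ = m^n>0 2 h
  ... | inj₁ emb = inj₁ emb
  ... | inj₂ (X , Y , X⊑U , Y⊑U , ∣X∣≥ , ∣Y∣≥ , sparse)
    with embedding-or-sparseSet h w X 1≤w n≤w
           (≤-trans (*-monoˡ-≤ w (≤-trans (m≤m+n (sparsityFactor d h) (2 ^ h)) (m≤m+n _ _))) ∣X∣≥)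
  ... | inj₁ emb = inj₁ emb
  ... | inj₂ (W₁ , W₁⊑X , ∣W₁∣≡ , E₁)
    with low-degree-part (4 * (2 ^ h * 2 ^ h)) W₁ Y
           (≤-trans (*-mono-≤ (m^n>0 2 h) 1≤w) (≤-reflexive (sym ∣W₁∣≡))) (λ x x∈W₁ → sparse x (W₁⊑X x x∈W₁))
  ... | Z , Z⊑Y , Z-spec , ∣Y∣≤
    -- `Y` has at least `2 * (sparsityFactor d h + 2 ^ h) * w` vertices. Removing `2 * card W₁`,
    -- which is `2 * (2 ^ h * w)`, and halving leaves enough in `Z`.
    with embedding-or-sparseSet h w Z 1≤w n≤w (*-cancelˡ-≤ 2 (+-cancelˡ-≤ (2 * card W₁) _ _
           (≤-trans (≤-reflexive (trans (cong (λ c → 2 * c + 2 * (sparsityFactor d h * w)) ∣W₁∣≡)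
                                        (regroup (sparsityFactor d h) (2 ^ h) w)))
                    (≤-trans ∣Y∣≥ ∣Y∣≤))))
    where
    regroup : ∀ q t w → 2 * (t * w) + 2 * (q * w) ≡ 2 * (q + t) * w
    regroup = solve-∀
  ... | inj₁ emb = inj₁ emb
  ... | inj₂ (W₂ , W₂⊑Z , ∣W₂∣≡ , E₂) = inj₂ (W , W⊑U , ∣W∣≡ , E)
    where
    t : ℕ
    t = 2 ^ h

    W : VSet N
    W x = W₁ x ∨ W₂ x

    part : Partition W W₁ W₂
    part x with W₂ x in x∈W₂
    ... | false with W₁ x
    ...   | false = refl
    ...   | true  = refl
    -- Disjointness holds because `Z` was chosen outside `W₁`.
    part x | true rewrite proj₁ (Z-spec x (W₂⊑Z x x∈W₂)) = refl

    W⊑U : W ⊑ U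
    W⊑U x x∈W with W₁ x in x∈W₁
    ... | true  = X⊑U x (W₁⊑X x x∈W₁)
    ... | false = Y⊑U x (Z⊑Y x (W₂⊑Z x x∈W))

    ∣W∣≡ : card W ≡ 2 ^ suc h * w
    ∣W∣≡ = trans (card-partition {A₁ = W₁} {W₂} part) (trans (cong₂ _+_ ∣W₁∣≡ ∣W₂∣≡) (double t w))
      where
      double : ∀ t w → t * w + t * w ≡ 2 * t * w
      double = solve-∀

    open ≤-Reasoning

    -- Vertices of `W₂` have low degree into `W₁`; the factor `4 * (t * t)` was chosen so that the
    -- cross pairs, counted in both directions, fit into one square `w * w`.
    cross : 2 * pairs F W₂ W₁ ≤ w * w
    cross = *-cancelˡ-≤ (2 * (t * t)) {{>-nonZero (*-mono-≤ (s≤s (z≤n {1})) (*-mono-≤ (m^n>0 2 h) (m^n>0 2 h)))}} (begin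
      2 * (t * t) * (2 * pairs F W₂ W₁)  ≡⟨ four (t * t) (pairs F W₂ W₁) ⟩
      4 * (t * t) * pairs F W₂ W₁        ≤⟨ pairs-bound F W₂ W₁ (4 * (t * t)) (λ y y∈W₂ → proj₂ (Z-spec y (W₂⊑Z y y∈W₂))) ⟩
      card W₂ * (2 * card W₁)            ≡⟨ cong₂ (λ a b → a * (2 * b)) ∣W₂∣≡ ∣W₁∣≡ ⟩
      t * w * (2 * (t * w))              ≡⟨ squares t w ⟩
      2 * (t * t) * (w * w)              ∎)
      where
      four : ∀ a b → 2 * a * (2 * b) ≡ 4 * a * b
      four = solve-∀
      squares : ∀ t w → t * w * (2 * (t * w)) ≡ 2 * (t * t) * (w * w)
      squares = solve-∀

    -- Each half brings a spare `w * w`: one pays for the cross pairs, the other restores the spare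
    -- square of the invariant.
    E : pairs F W W + w * w ≤ 2 ^ suc (suc h) * (w * w)
    E = begin
      pairs F W W + w * w
        ≡⟨ cong (_+ w * w) (pairs-partition F symF {A₁ = W₁} {W₂} part) ⟩
      pairs F W₁ W₁ + pairs F W₂ W₂ + 2 * pairs F W₂ W₁ + w * w
        ≤⟨ +-monoˡ-≤ (w * w) (+-monoʳ-≤ _ cross) ⟩
      pairs F W₁ W₁ + pairs F W₂ W₂ + w * w + w * w
        ≡⟨ pairUp (pairs F W₁ W₁) (pairs F W₂ W₂) (w * w) ⟩
      (pairs F W₁ W₁ + w * w) + (pairs F W₂ W₂ + w * w)
        ≤⟨ +-mono-≤ E₁ E₂ ⟩
      2 ^ suc h * (w * w) + 2 ^ suc h * (w * w)
        ≡⟨ double (2 ^ suc h) (w * w) ⟩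
      2 ^ suc (suc h) * (w * w) ∎
      where
      pairUp : ∀ a b c → a + b + c + c ≡ (a + c) + (b + c)
      pairUp = solve-∀
      double : ∀ s x → s * x + s * x ≡ 2 * s * x
      double = solve-∀

-- Multicoloured complete graphs

n<2^n : ∀ n → n < 2 ^ n
n<2^n zero    = s≤s z≤n
n<2^n (suc n) = ≤-trans (+-mono-≤ (m^n>0 2 n) (n<2^n n)) (≤-reflexive (cong (2 ^ n +_) (sym (+-identityʳ _))))

pairs-union : ∀ {N} {F G H : Rel₂ N} A → (∀ x y → ι (H x y) ≡ ι (F x y) + ι (G x y)) →
              pairs H A A ≡ pairs F A A + pairs G A A
pairs-union {F = F} {G} {H} A split = trans
  (sum-cong-≗ λ x → trans (cong (ι (A x) *_) (deg-union x)) (*-distribˡ-+ (ι (A x)) (deg F x A) (deg G x A)))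
  (∑-distrib-+ (λ x → ι (A x) * deg F x A) (λ x → ι (A x) * deg G x A))
  where
  deg-union : ∀ x → deg H x A ≡ deg F x A + deg G x A
  deg-union x = trans
    (sum-cong-≗ λ y → trans (cong (ι (A y) *_) (split x y)) (*-distribˡ-+ (ι (A y)) (ι (F x y)) (ι (G x y))))
    (∑-distrib-+ (λ y → ι (A y) * ι (F x y)) (λ y → ι (A y) * ι (G x y)))

-- With blocks of size `Q * w`, the sparse set has `Q * (2 ^ h * w)` vertices, as the recursion with
-- `2 ^ h * w` in place of `w` requires. The choice `h = 2 * (Q * Q)` makes its density small
-- enough.
ramseyFactor : ℕ → ℕ → ℕ
ramseyFactor d zero    = 1
ramseyFactor d (suc r) = let Q = ramseyFactor d r in suc (sparsityFactor d (2 * (Q * Q)) * Q)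

1≤ramseyFactor : ∀ d r → 1 ≤ ramseyFactor d r
1≤ramseyFactor d zero    = ≤-refl
1≤ramseyFactor d (suc r) = s≤s z≤n

module _ {N} (col : Fin N → Fin N → ℕ) where

  colourClass : ℕ → Rel₂ N
  colourClass i x y = does (col x y ≟ i)

  coloursFrom : ℕ → Rel₂ N
  coloursFrom r x y = does (r ≤? col x y)

  coloursFrom-split : ∀ r x y → ι (coloursFrom r x y) ≡ ι (coloursFrom (suc r) x y) + ι (colourClass r x y)
  coloursFrom-split r x y with <-cmp r (col x y)
  ... | tri< r<c r≢c _ = trans (cong ι (dec-true (r ≤? col x y) (<⇒≤ r<c)))
          (sym (cong₂ (λ a b → ι a + ι b) (dec-true (suc r ≤? col x y) r<c) (dec-false (col x y ≟ r) (r≢c ∘ sym))))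
  ... | tri≈ r≮c r≡c _ = trans (cong ι (dec-true (r ≤? col x y) (≤-reflexive r≡c)))
          (sym (cong₂ (λ a b → ι a + ι b) (dec-false (suc r ≤? col x y) r≮c) (dec-true (col x y ≟ r) (sym r≡c))))
  ... | tri> r≮c r≢c c<r = trans (cong ι (dec-false (r ≤? col x y) (<⇒≱ c<r)))
          (sym (cong₂ (λ a b → ι a + ι b) (dec-false (suc r ≤? col x y) r≮c) (dec-false (col x y ≟ r) (r≢c ∘ sym))))

module _ {n N} (adj : Fin n → Fin n → Bool) (symA : Symm adj) {d} (1≤d : 1 ≤ d)
         (deg≤d : ∀ v → card (adj v) ≤ d) (col : Fin N → Fin N → ℕ) (symC : ∀ x y → col x y ≡ col y x) where

  -- Colours ≥ r count as defects. If the adjacency graph does not embed in colour r, that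
  -- colour is sparse on a large subset and joins the defects there.
  ramsey : ∀ r w U → 1 ≤ w → n ≤ w → ramseyFactor d r * w ≤ card U → pairs (coloursFrom col r) U U < w * w →
           ∃ λ i → i < r × Embedding adj (colourClass col i)
  -- All ordered pairs in `U`, diagonal included, are now defects: at least `w * w` of them.
  ramsey zero w U _ _ ∣U∣≥ defects = contradiction defects (≤⇒≯ (begin
    w * w                        ≤⟨ *-mono-≤ w≤U w≤U ⟩
    card U * card U              ≡⟨ *-distribʳ-sum (card U) (ι ∘ U) ⟩
    sum (λ x → ι (U x) * card U) ≡⟨ sum-cong-≗ (λ x → cong (ι (U x) *_) (sum-cong-≗ λ y → sym (*-identityʳ (ι (U y))))) ⟩
    pairs (coloursFrom col 0) U U    ∎))
    where
    open ≤-Reasoning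
    w≤U : w ≤ card U
    w≤U = ≤-trans (≤-reflexive (sym (*-identityˡ w))) ∣U∣≥
  ramsey (suc r) w U 1≤w n≤w ∣U∣≥ defects = step
    where
    Q h t : ℕ
    Q = ramseyFactor d r
    h = 2 * (Q * Q)
    t = 2 ^ h

    w≤Qw : w ≤ Q * w
    w≤Qw = m≤n*m w Q {{>-nonZero (1≤ramseyFactor d r)}}

    F : Rel₂ N
    F = colourClass col r

    open ≤-Reasoning

    step : ∃ λ i → i < suc r × Embedding adj (colourClass col i)
    step with embedding-or-sparseSet adj symA 1≤d deg≤d F (λ x y → cong (λ c → does (c ≟ r)) (symC x y)) h (Q * w) U
                (≤-trans 1≤w w≤Qw) (≤-trans n≤w w≤Qw)
                (≤-trans (≤-reflexive (sym (*-assoc (sparsityFactor d h) Q w))) (≤-trans (m≤n+m _ w) ∣U∣≥))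
    ... | inj₁ emb = r , ≤-refl , emb
    ... | inj₂ (W , W⊑U , ∣W∣≡ , sparse)
      with ramsey r (t * w) W (*-mono-≤ (m^n>0 2 h) 1≤w) (≤-trans n≤w (m≤n*m w t {{>-nonZero (m^n>0 2 h)}}))
             (≤-reflexive (trans (exchange Q t w) (sym ∣W∣≡)))
             -- The old defects number fewer than `w * w`, which the spare square of the sparse set
             -- absorbs. Since `h = 2 * (Q * Q)`, the remaining bound is `h * (t * (w * w))`, and
             -- `h < 2 ^ h` finishes.
             (begin-strict
               pairs (coloursFrom col r) W W
                 ≡⟨ pairs-union W (coloursFrom-split col r) ⟩
               pairs (coloursFrom col (suc r)) W W + pairs F W W
                 ≤⟨ +-monoˡ-≤ (pairs F W W) (pairs-mono {F = coloursFrom col (suc r)} (λ _ _ → id) W⊑U) ⟩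
               pairs (coloursFrom col (suc r)) U U + pairs F W W
                 <⟨ +-monoˡ-< (pairs F W W) defects ⟩
               w * w + pairs F W W
                 ≤⟨ +-monoˡ-≤ (pairs F W W) (*-mono-≤ w≤Qw w≤Qw) ⟩
               Q * w * (Q * w) + pairs F W W
                 ≡⟨ +-comm (Q * w * (Q * w)) _ ⟩
               pairs F W W + Q * w * (Q * w)
                 ≤⟨ sparse ⟩
               2 ^ suc h * (Q * w * (Q * w))
                 ≡⟨ collect t Q w ⟩
               h * (t * (w * w))
                 ≤⟨ *-monoˡ-≤ (t * (w * w)) (<⇒≤ (n<2^n h)) ⟩
               t * (t * (w * w))
                 ≡⟨ square t w ⟩
               t * w * (t * w) ∎)
      where
      exchange : ∀ q t w → q * (t * w) ≡ t * (q * w)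
      exchange = solve-∀
      collect : ∀ t q w → 2 * t * (q * w * (q * w)) ≡ 2 * (q * q) * (t * (w * w))
      collect = solve-∀
      square : ∀ t w → t * (t * (w * w)) ≡ t * w * (t * w)
      square = solve-∀
    ... | i , i<r , emb = i , m<n⇒m<1+n i<r , emb

-- Reduction to coloured pairs

rank : ∀ {N} → Subset N → Fin N → ℕ
rank (s Vec.∷ p) zero    = 0
rank (s Vec.∷ p) (suc x) = ι s + rank p x

rank<∣p∣ : ∀ {N} {p : Subset N} {x} → x ∈ p → rank p x < ∣ p ∣
rank<∣p∣ Vec.here                              = s≤s z≤n
rank<∣p∣ {p = false Vec.∷ p} (Vec.there x∈p)   = rank<∣p∣ x∈p
rank<∣p∣ {p = true Vec.∷ p}  (Vec.there x∈p)   = s≤s (rank<∣p∣ x∈p)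

-- The rank increases exactly on passing an element of `p`, so it separates members of `p`.
rank-injective : ∀ {N} {p : Subset N} {x y} → x ∈ p → y ∈ p → rank p x ≡ rank p y → x ≡ y
rank-injective Vec.here Vec.here _ = refl
rank-injective {p = s Vec.∷ p} (Vec.there x∈p) (Vec.there y∈p) eq =
  cong suc (rank-injective x∈p y∈p (+-cancelˡ-≡ (ι s) _ _ eq))

colourIndex : Colour → Fin 2
colourIndex blue = zero
colourIndex red  = suc zero

indexColour : Fin 2 → Colour
indexColour zero    = blue
indexColour (suc _) = red

indexColour-colourIndex : ∀ c → indexColour (colourIndex c) ≡ c
indexColour-colourIndex blue = refl
indexColour-colourIndex red  = refl

module _ {k N} (1≤k : 1 ≤ k) (H : KGraph k N) (cov : Covering H) (χ : Colouring H) where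

  position : ∀ {e x} → x ∈ edge H e → Fin k
  position {e} x∈e = fromℕ< (≤-trans (rank<∣p∣ x∈e) (sizeHi H e))

  position-injective : ∀ {e x y} (x∈e : x ∈ edge H e) (y∈e : y ∈ edge H e) → position x∈e ≡ position y∈e → x ≡ y
  position-injective x∈e y∈e eq =
    rank-injective x∈e y∈e (trans (sym (F.toℕ-fromℕ< _)) (trans (cong toℕ eq) (F.toℕ-fromℕ< _)))

  -- The colour of the hyperedge is part of the code, so equal codes also force equally coloured
  -- hyperedges.
  code : ∀ {e x y} → x ∈ edge H e → y ∈ edge H e → Fin (2 * (k * k))
  code {e} x∈e y∈e = combine (colourIndex (χ e)) (combine (position x∈e) (position y∈e))

  code-injective : ∀ {e e′ x y x′ y′} → e ≡ e′ →
    (x∈e : x ∈ edge H e) (y∈e : y ∈ edge H e) (x′∈e′ : x′ ∈ edge H e′) (y′∈e′ : y′ ∈ edge H e′) →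
    code x∈e y∈e ≡ code x′∈e′ y′∈e′ → x ≡ x′ × y ≡ y′
  code-injective {e} refl x∈e y∈e x′∈e y′∈e eq =
    let (p , q) = combine-injective (position x∈e) (position y∈e) (position x′∈e) (position y′∈e)
                    (combine-injectiveʳ (colourIndex (χ e)) _ (colourIndex (χ e)) _ eq)
    in position-injective x∈e x′∈e p , position-injective y∈e y′∈e q

  -- The code depends on the order of its two vertices and is taken for the increasing order; `ends`
  -- records whether `x` and `y` come in the stored order or reversed.
  record Link (x y : Fin N) : Set where
    constructor link
    field
      {e}    : Fin (m H)
      {a b}  : Fin N
      a∈e    : a ∈ edge H e
      b∈e    : b ∈ edge H e
      ends   : (a ≡ x × b ≡ y) ⊎ (a ≡ y × b ≡ x)

    index : Fin (2 * (k * k))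
    index = code a∈e b∈e

    x∈e : x ∈ edge H e
    x∈e = [ (λ (p , _) → subst (_∈ edge H e) p a∈e) , (λ (_ , q) → subst (_∈ edge H e) q b∈e) ]′ ends

    y∈e : y ∈ edge H e
    y∈e = [ (λ (_ , q) → subst (_∈ edge H e) q b∈e) , (λ (p , _) → subst (_∈ edge H e) p a∈e) ]′ ends

  open Link

  orderedCode : ∀ x y → toℕ x < toℕ y → Fin (2 * (k * k))
  orderedCode x y x<y = let (e , x∈e , y∈e) = cov x y (F.<⇒≢ x<y) in code {e} x∈e y∈e

  pairColour : Fin N → Fin N → ℕ
  pairColour x y with F.<-cmp x y
  ... | tri< x<y _ _ = toℕ (orderedCode x y x<y)
  -- A default on the diagonal; an injective embedding never maps an edge there.
  ... | tri≈ _ _ _   = 0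
  ... | tri> _ _ y<x = toℕ (orderedCode y x y<x)

  pairColour-symm : ∀ x y → pairColour x y ≡ pairColour y x
  pairColour-symm x y with F.<-cmp x y | F.<-cmp y x
  ... | tri< x<y _ _ | tri< y<x _ _   = contradiction y<x (<-asym x<y)
  ... | tri< _ x≢y _ | tri≈ _ y≡x _   = contradiction (sym y≡x) x≢y
  ... | tri< x<y _ _ | tri> _ _ x<y′  = cong (toℕ ∘ orderedCode x y) (<-irrelevant x<y x<y′)
  ... | tri≈ _ x≡y _ | tri< _ y≢x _   = contradiction (sym x≡y) y≢x
  ... | tri≈ _ _ _   | tri≈ _ _ _     = refl
  ... | tri≈ _ x≡y _ | tri> _ y≢x _   = contradiction (sym x≡y) y≢x
  ... | tri> _ _ y<x | tri< y<x′ _ _  = cong (toℕ ∘ orderedCode y x) (<-irrelevant y<x y<x′)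
  ... | tri> _ x≢y _ | tri≈ _ y≡x _   = contradiction (sym y≡x) x≢y
  ... | tri> _ _ y<x | tri> _ _ x<y   = contradiction y<x (<-asym x<y)

  pairColour< : ∀ x y → pairColour x y < 2 * (k * k)
  pairColour< x y with F.<-cmp x y
  ... | tri< x<y _ _ = F.toℕ<n (orderedCode x y x<y)
  ... | tri≈ _ _ _   = ≤-trans (*-mono-≤ 1≤k 1≤k) (m≤m+n _ _)
  ... | tri> _ _ y<x = F.toℕ<n (orderedCode y x y<x)

  pairLink : ∀ x y → x ≢ y → Σ (Link x y) λ l → toℕ (index l) ≡ pairColour x y
  pairLink x y x≢y with F.<-cmp x y
  ... | tri< x<y _ _ = let (e , x∈e , y∈e) = cov x y (F.<⇒≢ x<y) in link {e = e} x∈e y∈e (inj₁ (refl , refl)) , refl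
  ... | tri≈ _ x≡y _ = contradiction x≡y x≢y
  ... | tri> _ _ y<x = let (e , y∈e , x∈e) = cov y x (F.<⇒≢ y<x) in link {e = e} y∈e x∈e (inj₂ (refl , refl)) , refl

  -- By `code-injective` the stored ordered pairs agree, so only the two orientations can differ.
  -- This makes the choice of hyperedges injective.
  link-unique : ∀ {x y x′ y′} (l : Link x y) (l′ : Link x′ y′) → e l ≡ e l′ → index l ≡ index l′ →
                (x ≡ x′ × y ≡ y′) ⊎ (x ≡ y′ × y ≡ x′)
  link-unique (link a∈e b∈e ends) (link a∈e′ b∈e′ ends′) e≡e′ eq with code-injective e≡e′ a∈e b∈e a∈e′ b∈e′ eq
  link-unique (link _ _ (inj₁ (refl , refl))) (link _ _ (inj₁ (refl , refl))) _ _ | refl , refl = inj₁ (refl , refl)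
  link-unique (link _ _ (inj₁ (refl , refl))) (link _ _ (inj₂ (refl , refl))) _ _ | refl , refl = inj₂ (refl , refl)
  link-unique (link _ _ (inj₂ (refl , refl))) (link _ _ (inj₁ (refl , refl))) _ _ | refl , refl = inj₂ (refl , refl)
  link-unique (link _ _ (inj₂ (refl , refl))) (link _ _ (inj₂ (refl , refl))) _ _ | refl , refl = inj₁ (refl , refl)

  -- The leading digit of the code is the colour, so a common index gives a common hyperedge colour.
  index-colour : ∀ {x y} (l : Link x y) → χ (e l) ≡ indexColour (proj₁ (remQuot (k * k) (index l)))
  index-colour l = sym (trans (cong (indexColour ∘ proj₁) (F.remQuot-combine {k = k * k} (colourIndex (χ (e l))) _))
                              (indexColour-colourIndex (χ (e l))))

  -- Every edge of `G` takes the hyperedge of its link. All these links share the index `i`, so they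
  -- share a colour, and a repeated hyperedge would mean a repeated pair.
  embedding⇒BergeCopy : ∀ {n} (G : Graph n) {i} → i < 2 * (k * k) →
    Embedding (adj G) (colourClass pairColour i) → ∃ λ c → BergeCopy H χ c G
  embedding⇒BergeCopy G {i} i<r (φ , inj , mono) =
    indexColour (proj₁ (remQuot (k * k) (fromℕ< i<r))) , φ , (λ g → e (proj₁ (linkOf g))) , inj , distinctEdges ,
    λ g → let (l , l≡i) = linkOf g in
      x∈e l , y∈e l , trans (index-colour l) (cong (indexColour ∘ proj₁ ∘ remQuot (k * k)) l≡i)
    where
    linkOf : ∀ ((( u , v) , _) : GEdge G) → Σ (Link (φ u) (φ v)) λ l → index l ≡ fromℕ< i<r
    linkOf ((u , v) , u<v , uv) =
      let (l , l≡) = pairLink (φ u) (φ v) (λ eq → F.<⇒≢ u<v (inj eq)) in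
      l , F.toℕ-injective (trans l≡ (trans (does-true (pairColour (φ u) (φ v) ≟ i) (mono u v u<v (T⇒true uv)))
                                           (sym (F.toℕ-fromℕ< i<r))))
      where
      T⇒true : ∀ {b} → T b → b ≡ true
      T⇒true {true} _ = refl

    distinctEdges : ∀ g g′ → e (proj₁ (linkOf g)) ≡ e (proj₁ (linkOf g′)) → proj₁ g ≡ proj₁ g′
    distinctEdges g@((u , v) , u<v , _) g′@((u′ , v′) , u′<v′ , _) eq
      with link-unique (proj₁ (linkOf g)) (proj₁ (linkOf g′)) eq (trans (proj₂ (linkOf g)) (sym (proj₂ (linkOf g′))))
    ... | inj₁ (p , q) = cong₂ _,_ (inj p) (inj q)
    -- Reversed orientation is impossible, since edges of `G` are stored with the smaller endpoint
    -- first.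
    ... | inj₂ (p , q) with inj p | inj q
    ...   | refl | refl = contradiction u′<v′ (<-asym u<v)

-- The linear bound for graphs of bounded degree

length-filterᵇ-tabulate : ∀ {n} {A : Set} (p : A → Bool) (f : Fin n → A) →
                          length (filterᵇ p (tabulate f)) ≡ card (p ∘ f)
length-filterᵇ-tabulate {zero}  p f = refl
length-filterᵇ-tabulate {suc n} p f with p (f zero)
... | false = length-filterᵇ-tabulate p (f ∘ suc)
... | true  = cong suc (length-filterᵇ-tabulate p (f ∘ suc))

card-full : ∀ N → card {N} (λ _ → true) ≡ N
card-full zero    = refl
card-full (suc N) = cong suc (card-full N)

pairs-empty : ∀ {N} (F : Rel₂ N) A → (∀ x y → F x y ≡ false) → pairs F A A ≡ 0
pairs-empty {N} F A empty = n≤0⇒n≡0 (begin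
  pairs F A A      ≡⟨ *-identityˡ _ ⟨
  1 * pairs F A A  ≤⟨ pairs-bound F A A 1 (λ x _ → ≤-reflexive (trans (*-identityˡ _) (deg≡0 x))) ⟩
  card A * 0       ≡⟨ *-zeroʳ (card A) ⟩
  0                ∎)
  where
  open ≤-Reasoning
  deg≡0 : ∀ x → deg F x A ≡ 0
  deg≡0 x = trans (sum-cong-≗ λ y → trans (cong (λ b → ι (A y) * ι b) (empty x y)) (*-zeroʳ (ι (A y))))
                  (sum-replicate-zero N)

theorem3 : ∀ (d k : ℕ) → 1 ≤ d → 1 ≤ k →
    Σ ℕ λ c → ∀ (n : ℕ) (G : Graph n) → MaxDegreeAtMost G d →
    CoverRamseyThreshold k G (c * n)
theorem3 d k 1≤d 1≤k = ramseyFactor d (2 * (k * k)) , threshold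
  where
  r : ℕ
  r = 2 * (k * k)

  threshold : ∀ n (G : Graph n) → MaxDegreeAtMost G d → CoverRamseyThreshold k G (ramseyFactor d r * n)
  -- `ramsey` is applied with `w = n` and needs `1 ≤ w`; the empty graph has an empty copy.
  threshold zero G _ N _ H cov χ = inj₁ ((λ ()) , (λ { ((() , _) , _) }) , (λ { {()} }) , (λ { ((() , _) , _) }) , λ { ((() , _) , _) })
  threshold n@(suc _) G maxDeg N N≥ H cov χ
    with ramsey (adj G) (symm G) 1≤d
           (λ v → ≤-trans (≤-reflexive (sym (length-filterᵇ-tabulate (adj G v) id))) (maxDeg v))
           col (pairColour-symm 1≤k H cov χ) r n (λ _ → true) (s≤s z≤n) ≤-refl
           (≤-trans N≥ (≤-reflexive (sym (card-full N))))
           -- Every pair colour is below `r`, so there are no defects at the start.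
           (≤-trans (s≤s (≤-reflexive (pairs-empty _ (λ _ → true)
             λ x y → dec-false (r ≤? col x y) (<⇒≱ (pairColour< 1≤k H cov χ x y))))) (s≤s z≤n))
    where
    col : Fin N → Fin N → ℕ
    col = pairColour 1≤k H cov χ
  ... | i , i<r , emb with embedding⇒BergeCopy 1≤k H cov χ G i<r emb
  ...   | blue , copy = inj₁ copy
  ...   | red  , copy = inj₂ copy
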